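{- Let $G$ be a connected graph of order $n \geq 2$. For any vertex $x$ of $G$ with eccentricity $\mathrm{e}(x)$ we have $p_x(G) \geq \frac{n-1}{\mathrm{e}(x)}$. Thus $\mathrm{vp}^-(G) \geq \frac{n-1}{\mathrm{diam}(G)}$ and $\mathrm{vp}(G) \geq \frac{n-1}{\mathrm{rad}(G)}$.
   Context: All graphs are finite, undirected and simple. A $u,v$-geodesic is a shortest $u,v$-path. The eccentricity of $x$ is $\mathrm{e}(x) = \max_{v \in V(G)} d(x,v)$; $\mathrm{diam}(G)$ and $\mathrm{rad}(G)$ are the maximum and minimum eccentricity over all vertices. For a vertex $x$ of $G$, a set $S \subseteq V(G)$ is an $x$-position set if for every $y \in S$ no vertex of $S \setminus \{y\}$ lies on any $x,y$-geodesic in $G$. The $x$-position number $p_x(G)$ is the maximum cardinality of an $x$-position set of $G$. Define $\mathrm{vp}(G) = \max_{x \in V(G)} p_x(G)$ and $\mathrm{vp}^-(G) = \min_{x \in V(G)} p_x(G)$. -}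

module Defs where

open import Data.Fin.Base using (Fin; zero; suc)
open import Data.Fin.Properties using (any?; all?; _≟_)
open import Data.Fin.Subset using (Subset; _∈_; ∣_∣; ⊥)
open import Data.Fin.Subset.Properties using (_∈?_; anySubset?; ∣p∣≤n; ∣⊥∣≡0; ∉⊥)
open import Data.List.Base using (tabulate)
open import Data.List.Extrema.Nat using (max; min; v<max⁺; v<min⁺)
import Data.List.Relation.Unary.All.Properties as All
import Data.List.Relation.Unary.Any.Properties as Any
import Data.Nat.Properties as ℕ
open import Data.Nat.Base
open import Data.Product.Base using (∃; _×_; _,_; proj₁; proj₂)
open import Data.Sum.Base using (inj₂)
open import Data.Vec.Base using (Vec; []; _∷_; head; last)
import Data.Vec.Membership.DecPropositional as DecMembership
open import Data.Vec.Membership.Propositional renaming (_∈_ to _∈ᵥ_) using ()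
open import Data.Vec.Relation.Unary.AllPairs using (allPairs?)
open import Data.Vec.Relation.Unary.Linked using (Linked; linked?)
open import Data.Vec.Relation.Unary.Unique.Propositional using (Unique)
open import Function.Base using (_∘_)
open import Level using (0ℓ)
open import Relation.Binary.Core using (Rel)
import Relation.Binary.Definitions as Binary
open import Relation.Binary.PropositionalEquality using (_≡_; _≢_; refl; subst)
open import Relation.Nullary using (¬_; Dec; yes; no; contradiction; ¬?; _×-dec_; _→-dec_)
open import Relation.Nullary.Decidable using (map′)
open import Relation.Unary using (Pred; Decidable)

IsLeast : Pred ℕ 0ℓ → ℕ → Set
IsLeast P k = P k × (∀ {j} → P j → k ≤ j)

IsGreatest : Pred ℕ 0ℓ → ℕ → Set
IsGreatest P k = P k × (∀ {j} → P j → j ≤ k)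

least : ∀ {P : Pred ℕ 0ℓ} → Decidable P → ∀ m → P m → ∃ (IsLeast P)
least P? zero p0 = 0 , p0 , λ _ → z≤n
least {P} P? (suc m) pm with P? 0
... | yes p0 = 0 , p0 , λ _ → z≤n
... | no ¬p0 with least {P ∘ suc} (P? ∘ suc) m pm
...   | k , pk , k≤ = suc k , pk , lower
  where
  lower : ∀ {j} → P j → suc k ≤ j
  lower {zero}  p0 = contradiction p0 ¬p0
  lower {suc j} pj = s≤s (k≤ pj)

greatest : ∀ {P : Pred ℕ 0ℓ} → Decidable P → ∃ P →
           ∀ b → (∀ {j} → P j → j ≤ b) → ∃ (IsGreatest P)
greatest P? nonempty b bound with P? b
... | yes pb = b , pb , bound
greatest {P} P? (m , pm) zero bound | no ¬p0 =
  contradiction (subst P (ℕ.n≤0⇒n≡0 (bound pm)) pm) ¬p0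
greatest {P} P? nonempty (suc b) bound | no ¬pb =
  greatest P? nonempty b λ pj →
    s≤s⁻¹ (ℕ.≤∧≢⇒< (bound pj) λ j≡b → ¬pb (subst P j≡b pj))

maximum minimum : ∀ {n} .{{_ : NonZero n}} → (Fin n → ℕ) → ℕ
maximum {suc n} f = max (f zero) (tabulate f)
minimum {suc n} f = min (f zero) (tabulate f)

anyVec? : ∀ {n k} {P : Pred (Vec (Fin n) k) 0ℓ} → Decidable P → Dec (∃ P)
anyVec? {k = zero}  P? = map′ (_ ,_) (λ where ([] , p) → p) (P? [])
anyVec? {k = suc k} P? =
  map′ (λ where (x , xs , p) → x ∷ xs , p) (λ where (x ∷ xs , p) → x , xs , p)
       (any? λ x → anyVec? (P? ∘ (x ∷_)))

record Graph (n : ℕ) : Set₁ where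
  field
    Adj    : Rel (Fin n) 0ℓ
    adj?   : Binary.Decidable Adj
    sym    : Binary.Symmetric Adj
    irrefl : Binary.Irreflexive _≡_ Adj

module _ {n : ℕ} (G : Graph n) where
  open Graph G

  -- A path of length k is given by the sequence of its k + 1 vertices.
  record IsPath (u v : Fin n) {k : ℕ} (w : Vec (Fin n) (suc k)) : Set where
    constructor mkPath
    field
      starts   : head w ≡ u
      ends     : last w ≡ v
      linked   : Linked Adj w
      distinct : Unique w

  HasPath : (u v : Fin n) → ℕ → Set
  HasPath u v k = ∃ λ (w : Vec (Fin n) (suc k)) → IsPath u v w

  IsGeodesic : (u v : Fin n) {k : ℕ} → Vec (Fin n) (suc k) → Set
  IsGeodesic u v {k} w = IsPath u v w × (∀ {j} → HasPath u v j → k ≤ j)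

  OnGeodesic : (u v z : Fin n) → Set
  OnGeodesic u v z =
    ∃ λ k → ∃ λ (w : Vec (Fin n) (suc k)) → IsGeodesic u v w × z ∈ᵥ w

  IsPositionSet : Fin n → Subset n → Set
  IsPositionSet x S =
    ∀ y → y ∈ S → ∀ z → z ∈ S → z ≢ y → ¬ OnGeodesic x y z

  Connected : Set
  Connected = ∀ u v → ∃ (HasPath u v)

  isPath? : ∀ u v {k} → Decidable (IsPath u v {k})
  isPath? u v w =
    map′ (λ where (a , b , c , d) → mkPath a b c d)
         (λ where (mkPath a b c d) → a , b , c , d)
         (head w ≟ u ×-dec last w ≟ v ×-dec linked? adj? w
           ×-dec allPairs? (λ a b → ¬? (a ≟ b)) w)

module Invariants {n : ℕ} .{{_ : NonZero n}}
                  (G : Graph n) (connected : Connected G) where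

  -- The opaque definitions are determined by their types; keeping them opaque
  -- stops conversion checking from unfolding the exhaustive searches.
  opaque
    shortest : ∀ u v → ∃ (IsLeast (HasPath G u v))
    shortest u v =
      let k , path = connected u v in least (λ _ → anyVec? (isPath? G u v)) k path

  d : Fin n → Fin n → ℕ
  d u v = proj₁ (shortest u v)

  e : Fin n → ℕ
  e x = maximum (d x)

  diam rad : ℕ
  diam = maximum e
  rad  = minimum e

  onGeodesic? : ∀ u v z → Dec (OnGeodesic G u v z)
  onGeodesic? u v z = map′ to from
    (anyVec? λ w → isPath? G u v {d u v} w ×-dec DecMembership._∈?_ _≟_ z w)
    where
    to : (∃ λ w → IsPath G u v {d u v} w × z ∈ᵥ w) → OnGeodesic G u v z
    to (w , path , z∈w) = d u v , w , (path , proj₂ (proj₂ (shortest u v))) , z∈w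

    from : OnGeodesic G u v z → ∃ λ w → IsPath G u v {d u v} w × z ∈ᵥ w
    from (k , w , (path , k≤) , z∈w) with shortest u v
    ... | l , hasPath , l≤ with ℕ.≤-antisym (k≤ hasPath) (l≤ (w , path))
    ... | refl = w , path , z∈w

  isPositionSet? : ∀ x → Decidable (IsPositionSet G x)
  isPositionSet? x S =
    all? λ y → y ∈? S →-dec
    all? λ z → z ∈? S →-dec (¬? (z ≟ y) →-dec ¬? (onGeodesic? x y z))

  HasPositionSet : Fin n → ℕ → Set
  HasPositionSet x m = ∃ λ S → IsPositionSet G x S × ∣ S ∣ ≡ m

  opaque
    largest : ∀ x → ∃ (IsGreatest (HasPositionSet x))
    largest x = greatest
      (λ m → anySubset? λ S → isPositionSet? x S ×-dec ∣ S ∣ ℕ.≟ m)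
      (0 , ⊥ , (λ y y∈⊥ → contradiction y∈⊥ ∉⊥) , ∣⊥∣≡0 n)
      n
      (λ where (S , _ , refl) → ∣p∣≤n S)

  p : Fin n → ℕ
  p x = proj₁ (largest x)

  vp vp⁻ : ℕ
  vp  = maximum p
  vp⁻ = minimum p

0<maximum : ∀ {n} .{{_ : NonZero n}} (f : Fin n → ℕ) i → 0 < f i → 0 < maximum f
0<maximum {suc n} f i 0<fi = v<max⁺ (f zero) _ (inj₂ (Any.tabulate⁺ {f = f} i 0<fi))

0<minimum : ∀ {n} .{{_ : NonZero n}} (f : Fin n → ℕ) → (∀ i → 0 < f i) → 0 < minimum f
0<minimum {suc n} f 0<f = v<min⁺ (0<f zero) (All.tabulate⁺ 0<f)

another : ∀ {n} .{{_ : NonTrivial n}} (x : Fin n) → ∃ λ y → x ≢ y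
another {2+ n} zero    = suc zero , λ ()
another {2+ n} (suc x) = zero , λ ()

-- The denominators in the bounds are nonzero for graphs of order at least two.
module Positivity {n : ℕ} .{{_ : NonZero n}} .{{_ : NonTrivial n}}
                  (G : Graph n) (connected : Connected G) where
  open Invariants G connected

  0<d : ∀ {x y} → x ≢ y → 0 < d x y
  0<d {x} {y} x≢y with shortest x y
  ... | zero  , (_ ∷ [] , mkPath refl refl _ _) , _ = contradiction refl x≢y
  ... | suc _ , _ = z<s

  0<e : ∀ x → 0 < e x
  0<e x = let y , x≢y = another x in 0<maximum (d x) y (0<d x≢y)

  aVertex : Fin n
  aVertex = vertex
    where
    vertex : ∀ {n} .{{_ : NonZero n}} → Fin n
    vertex {suc n} = zero

  instance
    e≢0 : ∀ {x} → NonZero (e x)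
    e≢0 {x} = >-nonZero (0<e x)

    diam≢0 : NonZero diam
    diam≢0 = >-nonZero (0<maximum e aVertex (0<e aVertex))

    rad≢0 : NonZero rad
    rad≢0 = >-nonZero (0<minimum e 0<e)

-- The vertices at a fixed distance k from x form an x-position set: a vertex other
-- than y on an x,y-geodesic is strictly closer to x than y is. The n − 1 vertices
-- different from x are covered by the spheres of radius 1, …, e(x), each of which
-- has at most p x elements, so n − 1 ≤ p x · e x.

module Submission where

open import Defs
open import Data.Fin.Base using (Fin; zero; suc)
open import Data.Fin.Subset using (Subset; inside; outside; _∈_; _⊆_; _∪_; ∣_∣; ⁅_⁆; ⊤)
open import Data.Fin.Subset.Properties
  using (∣⊤∣≡n; x∈⁅x⁆; ∣⁅x⁆∣≡1; p⊆q⇒∣p∣≤∣q∣; x∈p∪q⁺)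
open import Data.Integer.Base using (+_; +≤+)
import Data.Integer.Properties as ℤ
open import Data.List.Base using (tabulate)
import Data.Nat.Properties as ℕ
open import Data.List.Extrema ℕ.≤-totalOrder using (argmin-sel)
open import Data.List.Extrema.Nat using (max; xs≤max)
import Data.List.Membership.Propositional.Properties as List
import Data.List.Relation.Unary.All.Properties as ListAll
open import Data.Nat.Base
  using (ℕ; zero; suc; NonTrivial; NonZero; nonTrivial⇒nonZero; _∸_; _+_; _*_; _≤_; _<_;
         z≤n; s≤s; z<s; s<s)
open import Data.Product.Base using (∃; _×_; _,_; proj₁; proj₂)
open import Data.Rational.Base using (_/_; _≥_; fromℚᵘ) renaming (_≤_ to _≤ℚ_)
import Data.Rational.Properties as ℚ
open import Data.Rational.Unnormalised.Base using (mkℚᵘ; *≤*) renaming (_≤_ to _≤ᵘ_)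
import Data.Rational.Unnormalised.Properties as ℚᵘ
open import Data.Sum.Base using (inj₁; inj₂)
import Data.Vec.Base as Vec
open import Data.Vec.Base using (Vec; []; _∷_)
open import Data.Vec.Membership.Propositional using () renaming (_∈_ to _∈ᵥ_)
import Data.Vec.Properties as Vec
open import Data.Vec.Relation.Unary.All using (All; []; _∷_)
open import Data.Vec.Relation.Unary.AllPairs using ([]; _∷_)
open import Data.Vec.Relation.Unary.Any using (here; there)
open import Data.Vec.Relation.Unary.Linked using ([-]; _∷_)
open import Function.Base using (_∘_)
open import Level using (0ℓ)
open import Relation.Binary.PropositionalEquality
  using (_≡_; _≢_; refl; sym; trans; cong; subst)
open import Relation.Nullary using (yes; no; does; contradiction)
open import Relation.Nullary.Decidable using (dec-true; dec-false)
open import Relation.Unary using (Pred; Decidable)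

∣p∪q∣≤∣p∣+∣q∣ : ∀ {n} (p q : Subset n) → ∣ p ∪ q ∣ ≤ ∣ p ∣ + ∣ q ∣
∣p∪q∣≤∣p∣+∣q∣ []            []            = z≤n
∣p∪q∣≤∣p∣+∣q∣ (outside ∷ p) (outside ∷ q) = ∣p∪q∣≤∣p∣+∣q∣ p q
∣p∪q∣≤∣p∣+∣q∣ (outside ∷ p) (inside  ∷ q) =
  ℕ.≤-trans (s≤s (∣p∪q∣≤∣p∣+∣q∣ p q)) (ℕ.≤-reflexive (sym (ℕ.+-suc ∣ p ∣ ∣ q ∣)))
∣p∪q∣≤∣p∣+∣q∣ (inside  ∷ p) (outside ∷ q) = s≤s (∣p∪q∣≤∣p∣+∣q∣ p q)
∣p∪q∣≤∣p∣+∣q∣ (inside  ∷ p) (inside  ∷ q) =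
  s≤s (ℕ.≤-trans (∣p∪q∣≤∣p∣+∣q∣ p q) (ℕ.+-monoʳ-≤ ∣ p ∣ (ℕ.n≤1+n ∣ q ∣)))

module _ {n : ℕ} {P : Pred (Fin n) 0ℓ} (P? : Decidable P) where

  comprehension : Subset n
  comprehension = Vec.tabulate (does ∘ P?)

  ∈-comprehension⁺ : ∀ {i} → P i → i ∈ comprehension
  ∈-comprehension⁺ {i} pi = Vec.lookup⇒[]= i comprehension
    (trans (Vec.lookup∘tabulate (does ∘ P?) i) (dec-true (P? i) pi))

  ∈-comprehension⁻ : ∀ {i} → i ∈ comprehension → P i
  ∈-comprehension⁻ {i} i∈ with P? i in eq
  ... | yes pi = pi
  ... | no ¬pi = contradiction
    (trans (sym (Vec.[]=⇒lookup i∈))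
      (trans (Vec.lookup∘tabulate (does ∘ P?) i) (dec-false (P? i) ¬pi)))
    λ ()

≤-maximum : ∀ {n} .{{_ : NonZero n}} (f : Fin n → ℕ) i → f i ≤ maximum f
≤-maximum {suc n} f = ListAll.tabulate⁻ (xs≤max (f zero) (tabulate f))

minimum-attained : ∀ {n} .{{_ : NonZero n}} (f : Fin n → ℕ) → ∃ λ i → minimum f ≡ f i
-- `min` is `argmin` of the identity, so the selection property is taken at the identity.
minimum-attained {suc n} f with argmin-sel (λ k → k) (f zero) (tabulate f)
... | inj₁ min≡f0 = zero , min≡f0
... | inj₂ min∈f  = List.∈-tabulate⁻ min∈f

fromℚᵘ-mono-≤ : ∀ {p q} → p ≤ᵘ q → fromℚᵘ p ≤ℚ fromℚᵘ q
fromℚᵘ-mono-≤ {p} {q} p≤q = ℚ.toℚᵘ-cancel-≤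
  (ℚᵘ.≤-respˡ-≃ (ℚᵘ.≃-sym (ℚ.toℚᵘ-fromℚᵘ p))
    (ℚᵘ.≤-respʳ-≃ (ℚᵘ.≃-sym (ℚ.toℚᵘ-fromℚᵘ q)) p≤q))

-- The order on unnormalised rationals is cross-multiplication, so no common factor has to be
-- cancelled before comparing.
a≤b*m⇒b/1≥a/m : ∀ {a} b m .{{_ : NonZero m}} → a ≤ b * m → + b / 1 ≥ + a / m
-- `mkℚᵘ` stores the denominator minus one: `m` encodes `suc m` and `0` encodes `1`.
a≤b*m⇒b/1≥a/m {a} b (suc m) a≤b*m = fromℚᵘ-mono-≤ {mkℚᵘ (+ a) m} {mkℚᵘ (+ b) 0}
  (*≤* (ℤ.≤-trans (ℤ.≤-reflexive (ℤ.*-identityʳ (+ a)))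
    (ℤ.≤-trans (+≤+ a≤b*m) (ℤ.≤-reflexive (ℤ.pos-* b (suc m))))))

module _ {n : ℕ} (G : Graph n) where
  open Graph G using (Adj)

  -- Restricting All to the prefix is what keeps the prefix distinct when the path is extended on the left.
  properPrefix : ∀ {u v z k} {w : Vec (Fin n) (suc k)} → IsPath G u v w → z ∈ᵥ w → z ≢ v →
    ∃ λ j → j < k × ∃ λ (w′ : Vec (Fin n) (suc j)) →
      IsPath G u z w′ × (∀ {P : Pred (Fin n) 0ℓ} → All P w → All P w′)
  properPrefix {w = _ ∷ []} (mkPath _ refl _ _) (here refl) z≢v = contradiction refl z≢v
  properPrefix {w = x ∷ _ ∷ _} (mkPath refl _ _ _) (here refl) _ =
    0 , z<s , x ∷ [] , mkPath refl refl [-] ([] ∷ []) , λ where (px ∷ _) → px ∷ []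
  properPrefix {w = x ∷ _ ∷ _} (mkPath refl refl (x~y ∷ linked) (x∉ ∷ distinct)) (there z∈) z≢v =
    let j , j<k , w′ , mkPath starts ends linked′ distinct′ , restrict =
          properPrefix (mkPath refl refl linked distinct) z∈ z≢v
    in suc j , s<s j<k , x ∷ w′
     , mkPath refl (trans (last-∷ x w′) ends)
         (subst (Adj x) (sym starts) x~y ∷ linked′) (restrict x∉ ∷ distinct′)
     , λ where (px ∷ pw) → px ∷ restrict pw
    where
    last-∷ : ∀ {j} (x : Fin n) (w : Vec (Fin n) (suc j)) → Vec.last (x ∷ w) ≡ Vec.last w
    last-∷ x (_ ∷ _) = refl

module _ {n : ℕ} .{{_ : NonZero n}} (G : Graph n) (connected : Connected G) where
  open Invariants G connected

  d-minimal : ∀ {u v k} → HasPath G u v k → d u v ≤ k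
  d-minimal {u} {v} = proj₂ (proj₂ (shortest u v))

  d≡0⇒≡ : ∀ {u v} → d u v ≡ 0 → u ≡ v
  d≡0⇒≡ {u} {v} d≡0 with shortest u v
  d≡0⇒≡ refl | zero , (_ ∷ [] , mkPath refl refl _ _) , _ = refl

  -- Cutting the geodesic at `z` gives a path to `z` with fewer edges, which bounds `d x z`. The
  -- geodesic itself is no longer than the shortest path that realises `d x y`.
  onGeodesic⇒closer : ∀ {x y z} → OnGeodesic G x y z → z ≢ y → d x z < d x y
  onGeodesic⇒closer {x} {y} (k , w , (path , k≤) , z∈w) z≢y =
    let j , j<k , w′ , path′ , _ = properPrefix G path z∈w z≢y
    in ℕ.≤-<-trans (d-minimal (w′ , path′))
         (ℕ.<-≤-trans j<k (k≤ (proj₁ (proj₂ (shortest x y)))))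

  atDistance? : ∀ x k → Decidable λ v → d x v ≡ k
  atDistance? x k v = d x v ℕ.≟ k

  sphere : Fin n → ℕ → Subset n
  sphere x k = comprehension (atDistance? x k)

  sphere-isPositionSet : ∀ x k → IsPositionSet G x (sphere x k)
  sphere-isPositionSet x k y y∈ z z∈ z≢y onGeodesic =
    ℕ.<-irrefl (trans (∈-comprehension⁻ (atDistance? x k) z∈) (sym (∈-comprehension⁻ (atDistance? x k) y∈)))
      (onGeodesic⇒closer onGeodesic z≢y)

  ∣sphere∣≤p : ∀ x k → ∣ sphere x k ∣ ≤ p x
  ∣sphere∣≤p x k = proj₂ (proj₂ (largest x)) (sphere x k , sphere-isPositionSet x k , refl)

  -- A union of spheres rather than one comprehension, so that its size can be bounded one sphere at
  -- a time. Starting from the singleton makes the centre count as exactly 1 and not as a further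
  -- `p x`.
  ball : Fin n → ℕ → Subset n
  ball x zero    = ⁅ x ⁆
  ball x (suc k) = sphere x (suc k) ∪ ball x k

  ∈-ball : ∀ {x v} k → d x v ≤ k → v ∈ ball x k
  ∈-ball {x} zero d≤0 with refl ← d≡0⇒≡ (ℕ.n≤0⇒n≡0 d≤0) = x∈⁅x⁆ x
  ∈-ball {x} (suc k) d≤1+k with ℕ.m≤n⇒m<n∨m≡n d≤1+k
  ... | inj₁ d<1+k = x∈p∪q⁺ (inj₂ (∈-ball k (ℕ.≤-pred d<1+k)))
  ... | inj₂ d≡1+k = x∈p∪q⁺ (inj₁ (∈-comprehension⁺ (atDistance? x (suc k)) d≡1+k))

  ∣ball∣≤1+k*p : ∀ x k → ∣ ball x k ∣ ≤ 1 + k * p x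
  ∣ball∣≤1+k*p x zero    = ℕ.≤-reflexive (∣⁅x⁆∣≡1 x)
  ∣ball∣≤1+k*p x (suc k) = begin
    ∣ sphere x (suc k) ∪ ball x k ∣     ≤⟨ ∣p∪q∣≤∣p∣+∣q∣ (sphere x (suc k)) (ball x k) ⟩
    ∣ sphere x (suc k) ∣ + ∣ ball x k ∣ ≤⟨ ℕ.+-mono-≤ (∣sphere∣≤p x (suc k)) (∣ball∣≤1+k*p x k) ⟩
    p x + (1 + k * p x)                 ≡⟨ ℕ.+-suc (p x) (k * p x) ⟩
    1 + suc k * p x                     ∎
    where open ℕ.≤-Reasoning

  n∸1≤p*e : ∀ x → n ∸ 1 ≤ p x * e x
  n∸1≤p*e x = begin
    n ∸ 1                    ≡⟨ cong (_∸ 1) (∣⊤∣≡n n) ⟨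
    ∣ ⊤ {n} ∣ ∸ 1            ≤⟨ ℕ.∸-monoˡ-≤ 1 (p⊆q⇒∣p∣≤∣q∣ ⊤⊆ball) ⟩
    -- The ball has at most `1 + e x * p x` vertices, and the 1 for the centre cancels with `∸ 1` by
    -- computation.
    ∣ ball x (e x) ∣ ∸ 1     ≤⟨ ℕ.∸-monoˡ-≤ 1 (∣ball∣≤1+k*p x (e x)) ⟩
    e x * p x                ≡⟨ ℕ.*-comm (e x) (p x) ⟩
    p x * e x                ∎
    where
    open ℕ.≤-Reasoning

    -- The eccentricity is the largest distance from `x`, so a ball of that radius reaches every
    -- vertex.
    ⊤⊆ball : ⊤ ⊆ ball x (e x)
    ⊤⊆ball {v} _ = ∈-ball (e x) (≤-maximum (d x) v)

  -- Apply the vertex bound where `p` is smallest; the eccentricity there may be anything up to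
  -- `diam`.
  n∸1≤vp⁻*diam : n ∸ 1 ≤ vp⁻ * diam
  n∸1≤vp⁻*diam with x , vp⁻≡px ← minimum-attained p =
    ℕ.≤-trans (n∸1≤p*e x) (ℕ.*-mono-≤ (ℕ.≤-reflexive (sym vp⁻≡px)) (≤-maximum e x))

  -- Here the vertex is a central one, of eccentricity `rad`, and its position number is estimated
  -- by `vp`.
  n∸1≤vp*rad : n ∸ 1 ≤ vp * rad
  n∸1≤vp*rad with x , rad≡ex ← minimum-attained e =
    ℕ.≤-trans (n∸1≤p*e x) (ℕ.*-mono-≤ (≤-maximum p x) (ℕ.≤-reflexive (sym rad≡ex)))

lemma2p6 : ∀ (n : ℕ) .{{_ : NonTrivial n}} (G : Graph n) (connected : Connected G) →
    let instance
          n≢0 : NonZero n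
          n≢0 = nonTrivial⇒nonZero n
        open Invariants G connected
        open Positivity G connected
    in (∀ (x : Fin n) → + p x / 1 ≥ + (n ∸ 1) / e x)
       × + vp⁻ / 1 ≥ + (n ∸ 1) / diam
       × + vp / 1 ≥ + (n ∸ 1) / rad
lemma2p6 n G connected =
    -- All three quotients come from product bounds in `ℕ`; the instances of `Positivity` supply the
    -- nonzero denominators.
    (λ x → a≤b*m⇒b/1≥a/m (p x) (e x) (n∸1≤p*e G connected x))
  , a≤b*m⇒b/1≥a/m vp⁻ diam (n∸1≤vp⁻*diam G connected)
  , a≤b*m⇒b/1≥a/m vp rad (n∸1≤vp*rad G connected)
  where
  instance
    n≢0 : NonZero n
    n≢0 = nonTrivial⇒nonZero n
  open Invariants G connected
  open Positivity G connected
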